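{- Let $D=(V,A)$ be a digraph with $n=|V|$ vertices and minimum in-degree $\delta^{ - }=\delta^{ - }(D)$, and let $k$ be an integer with $1\le k\le \delta^{ - }$. Put $\delta^{ -\prime}=\delta^{ - }-k+1$. Then $$\gamma_k(D)\ \le\ \left(1-\frac{\delta^{ -\prime}}{\binom{\delta^{ - }}{k-1}^{1/\delta^{ -\prime}}\cdot\left(1+\delta^{ -\prime}\right)^{1+1/\delta^{ -\prime}}}\right)n,$$ where $\gamma_k(D)$ denotes the $k$-domination number of $D$.
   Context: A digraph $D=(V,A)$ consists of a finite set $V$ of vertices and a set $A$ of ordered pairs of distinct vertices, called arcs (so there are no loops and no multiple arcs, but both $(u,v)$ and $(v,u)$ may be present). The in-neighbourhood of a vertex $v$ is $N^-(v)=\{u\in V \mid (u,v)\in A\}$, the in-degree of $v$ is $d^-(v)=|N^-(v)|$, and the minimum in-degree of $D$ is $\delta^-(D)=\min_{v\in V} d^-(v)$. For an integer $k\ge 1$, a set $X\subseteq V$ is a $k$-dominating set of $D$ if every vertex $v\in V$ satisfies $v\in X$ or $|N^-(v)\cap X|\ge k$. The $k$-domination number $\gamma_k(D)$ is the smallest cardinality of a $k$-dominating set of $D$. -}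

module Defs where

open import Data.Fin.Base using (Fin)
open import Data.Fin.Properties using (all?)
open import Data.Fin.Subset using (Subset; inside; outside; _∈_; _∩_; ∣_∣; ⊤)
open import Data.Fin.Subset.Properties using (_∈?_; ∈⊤; ∣⊤∣≡n)
open import Data.Integer.Base as ℤ using (+_; +[1+_])
import Data.Integer.Properties as ℤ
open import Data.List.Base using (List; []; _∷_; map; filter; allFin; _++_)
open import Data.List.Extrema.Nat using (min; min≤xs; argmin-sel)
open import Data.List.Membership.Propositional using () renaming (_∈_ to _∈ˡ_)
open import Data.List.Membership.Propositional.Properties
  using (∈-map⁺; ∈-map⁻; ∈-filter⁺; ∈-filter⁻; ∈-++⁺ˡ; ∈-++⁺ʳ)
import Data.List.Relation.Unary.All as All
open import Data.List.Relation.Unary.Any using (here)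
open import Data.Nat.Base as ℕ using (ℕ; zero; suc; z≤n; s≤s)
open import Data.Nat.Combinatorics using (_C_; nCk+nC[k+1]≡[n+1]C[k+1])
import Data.Nat.Properties as ℕ
open import Data.Product.Base using (∃-syntax; _×_; _,_; proj₂)
open import Data.Rational.Base hiding (∣_∣)
open import Data.Rational.Base using () renaming (∣_∣ to ∣_∣ℚ)
import Data.Rational.Properties as ℚ
open import Data.Rational.Solver using (module +-*-Solver)
open import Data.Rational.Unnormalised.Base as ℚᵘ using (ℚᵘ; mkℚᵘ)
import Data.Rational.Unnormalised.Properties as ℚᵘ
open import Data.Sum.Base using (_⊎_; inj₁; inj₂)
open import Data.Vec.Base using ([]; _∷_; tabulate)
open import Function.Base using (id)
open import Level using (0ℓ)
open import Relation.Binary.Core using (Rel)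
open import Relation.Binary.Definitions using (Decidable)
open import Relation.Binary.PropositionalEquality
import Relation.Binary.Reasoning.Setoid as ≈-Reasoning
open import Relation.Nullary.Decidable using (Dec; yes; no; does; _⊎-dec_)
open import Relation.Nullary.Negation using (¬_; contradiction)

open +-*-Solver using (solve; _:+_; _:*_; _:-_; :-_; _:=_; con)

record Digraph (n : ℕ) : Set₁ where
  field
    Arc      : Rel (Fin n) 0ℓ
    arc?     : Decidable Arc
    loopless : ∀ v → ¬ Arc v v

module _ {n : ℕ} (D : Digraph n) where
  open Digraph D

  N⁻ : Fin n → Subset n
  N⁻ v = tabulate (λ u → does (arc? u v))

  d⁻ : Fin n → ℕ
  d⁻ v = ∣ N⁻ v ∣

  -- There are no loops, so every in-degree is less than n and the default n is
  -- never the minimum unless n = 0, where δ⁻ is 0.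
  δ⁻ : ℕ
  δ⁻ = min n (map d⁻ (allFin n))

  Dominating : ℕ → Subset n → Set
  Dominating k X = ∀ v → v ∈ X ⊎ k ℕ.≤ ∣ N⁻ v ∩ X ∣

  dominating? : ∀ k X → Dec (Dominating k X)
  dominating? k X = all? (λ v → (v ∈? X) ⊎-dec (k ℕ.≤? ∣ N⁻ v ∩ X ∣))

subsets : ∀ n → List (Subset n)
subsets zero    = [] ∷ []
subsets (suc n) = map (inside ∷_) (subsets n) ++ map (outside ∷_) (subsets n)

-- The default n is the cardinality of the k-dominating set V.
γ : ∀ {n} → ℕ → Digraph n → ℕ
γ {n} k D = min n (map ∣_∣ (filter (dominating? D k) (subsets n)))

∈-subsets : ∀ {n} (X : Subset n) → X ∈ˡ subsets n
∈-subsets []            = here refl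
∈-subsets (inside  ∷ X) = ∈-++⁺ˡ (∈-map⁺ (inside ∷_) (∈-subsets X))
∈-subsets (outside ∷ X) = ∈-++⁺ʳ (map (inside ∷_) (subsets _)) (∈-map⁺ (outside ∷_) (∈-subsets X))

γ-minimal : ∀ {n} k (D : Digraph n) X → Dominating D k X → γ k D ℕ.≤ ∣ X ∣
γ-minimal {n} k D X dom =
  All.lookup (min≤xs n _) (∈-map⁺ ∣_∣ (∈-filter⁺ (dominating? D k) (∈-subsets X) dom))

γ-attained : ∀ {n} k (D : Digraph n) → ∃[ X ] Dominating D k X × ∣ X ∣ ≡ γ k D
γ-attained {n} k D with argmin-sel id n (map ∣_∣ (filter (dominating? D k) (subsets n)))
... | inj₁ γ≡n = ⊤ , (λ _ → inj₁ ∈⊤) , trans (∣⊤∣≡n n) (sym γ≡n)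
... | inj₂ γ∈  with X , X∈ , γ≡∣X∣ ← ∈-map⁻ ∣_∣ γ∈ =
  X , proj₂ (∈-filter⁻ (dominating? D k) {xs = subsets n} X∈) , sym γ≡∣X∣

Cauchy : (ℕ → ℚ) → Set
Cauchy x = ∀ ε → 0ℚ < ε → ∃[ N ] (∀ m n → N ℕ.≤ m → N ℕ.≤ n → ∣ x m - x n ∣ℚ < ε)

-- Without eta, and with the operations defined by copatterns, an expression
-- such as x *ᴿ y does not unfold when instances are resolved.
record ℝ : Set where
  no-eta-equality
  field
    seq    : ℕ → ℚ
    cauchy : Cauchy seq

open ℝ public

infix  4 _≤ᴿ_
infixl 6 _-ᴿ_
infixl 7 _*ᴿ_ _÷ᴿ_
infixr 8 _^ᴿ_

_≤ᴿ_ : ℝ → ℝ → Set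
x ≤ᴿ y = ∀ ε → 0ℚ < ε → ∃[ N ] (∀ m → N ℕ.≤ m → seq x m ≤ seq y m + ε)

record Positiveᴿ (x : ℝ) : Set where
  field
    bound     : ℚ
    bound>0   : 0ℚ < bound
    threshold : ℕ
    above     : ∀ m → threshold ℕ.≤ m → bound ≤ seq x m

∣p∣<r : ∀ {p r} → p < r → - p < r → ∣ p ∣ℚ < r
∣p∣<r {p} {r} p<r -p<r with ℚ.∣p∣≡p∨∣p∣≡-p p
... | inj₁ eq = subst (_< r) (sym eq) p<r
... | inj₂ eq = subst (_< r) (sym eq) -p<r

p<r+q⇒p-q<r : ∀ p q r → p < r + q → p - q < r
p<r+q⇒p-q<r p q r lt =
  subst (p - q <_) (solve 2 (λ r q → r :+ q :- q := r) refl r q) (ℚ.+-monoˡ-< (- q) lt)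

*-pos : ∀ {p q} → 0ℚ < p → 0ℚ < q → 0ℚ < p * q
*-pos {p} {q} 0<p 0<q =
  ℚ.positive⁻¹ (p * q) {{ℚ.pos*pos⇒pos p {{positive 0<p}} q {{positive 0<q}}}}

*-mono-≤ : ∀ {p q r s} → 0ℚ ≤ r → 0ℚ ≤ q → p ≤ q → r ≤ s → p * r ≤ q * s
*-mono-≤ {p} {q} {r} {s} 0≤r 0≤q p≤q r≤s = ℚ.≤-trans
  (ℚ.*-monoʳ-≤-nonNeg r {{nonNegative 0≤r}} p≤q)
  (ℚ.*-monoˡ-≤-nonNeg q {{nonNegative 0≤q}} r≤s)

split : ∀ ε K → 0ℚ < ε → 0ℚ < K → ∃[ η ] 0ℚ < η × K * η ≡ ε
split ε K 0<ε 0<K = ε * u , *-pos 0<ε 0<u , eq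
  where
  instance
    _ = positive 0<K
    _ = ℚ.pos⇒nonZero K
  u : ℚ
  u = 1/ K
  0<u : 0ℚ < u
  0<u = ℚ.positive⁻¹ u {{ℚ.1/pos⇒pos K}}
  eq : K * (ε * u) ≡ ε
  eq = begin
    K * (ε * u)  ≡⟨ solve 3 (λ K ε u → K :* (ε :* u) := ε :* (K :* u)) refl K ε u ⟩
    ε * (K * u)  ≡⟨ cong (ε *_) (ℚ.*-inverseʳ K) ⟩
    ε * 1ℚ       ≡⟨ ℚ.*-identityʳ ε ⟩
    ε            ∎
    where open ≡-Reasoning

fromℚ : ℚ → ℝ
fromℚ p .seq _ = p
fromℚ p .cauchy = λ ε 0<ε → 0 , λ _ _ _ _ →
  subst (_< ε) (sym (cong ∣_∣ℚ (ℚ.+-inverseʳ p))) 0<ε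

fromℕ : ℕ → ℝ
fromℕ n = fromℚ (+ n / 1)

_-ᴿ_ : ℝ → ℝ → ℝ
(x -ᴿ y) .seq m = seq x m - seq y m
(x -ᴿ y) .cauchy = λ ε 0<ε →
  let η , 0<η , 2η≡ε = split ε (1ℚ + 1ℚ) 0<ε (ℚ.positive⁻¹ (1ℚ + 1ℚ))
      M , x-close = cauchy x η 0<η
      N , y-close = cauchy y η 0<η
  in M ℕ.⊔ N , λ m n M⊔N≤m M⊔N≤n →
    let open ℚ.≤-Reasoning
        a = seq x m ; b = seq y m ; c = seq x n ; d = seq y n
    in begin-strict
      ∣ (a - b) - (c - d) ∣ℚ
        ≡⟨ cong ∣_∣ℚ (solve 4 (λ a b c d → (a :- b) :- (c :- d) := (a :- c) :+ (d :- b)) refl a b c d) ⟩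
      ∣ (a - c) + (d - b) ∣ℚ
        ≤⟨ ℚ.∣p+q∣≤∣p∣+∣q∣ (a - c) (d - b) ⟩
      ∣ a - c ∣ℚ + ∣ d - b ∣ℚ
        <⟨ ℚ.+-mono-<
             (x-close m n (ℕ.m⊔n≤o⇒m≤o M N M⊔N≤m) (ℕ.m⊔n≤o⇒m≤o M N M⊔N≤n))
             (y-close n m (ℕ.m⊔n≤o⇒n≤o M N M⊔N≤n) (ℕ.m⊔n≤o⇒n≤o M N M⊔N≤m)) ⟩
      η + η
        ≡⟨ solve 1 (λ η → η :+ η := (con 1ℚ :+ con 1ℚ) :* η) refl η ⟩
      (1ℚ + 1ℚ) * η
        ≡⟨ 2η≡ε ⟩
      ε ∎

eventually-bounded : ∀ x → ∃[ K ] 0ℚ < K × ∃[ N ] (∀ m → N ℕ.≤ m → ∣ seq x m ∣ℚ ≤ K)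
eventually-bounded x with N , close ← cauchy x 1ℚ (ℚ.positive⁻¹ 1ℚ) =
  1ℚ + ∣ c ∣ℚ , ℚ.+-mono-<-≤ (ℚ.positive⁻¹ 1ℚ) (ℚ.0≤∣p∣ c) , N , λ m N≤m → begin
    ∣ seq x m ∣ℚ
      ≡⟨ cong ∣_∣ℚ (solve 2 (λ a c → a := (a :- c) :+ c) refl (seq x m) c) ⟩
    ∣ (seq x m - c) + c ∣ℚ
      ≤⟨ ℚ.∣p+q∣≤∣p∣+∣q∣ (seq x m - c) c ⟩
    ∣ seq x m - c ∣ℚ + ∣ c ∣ℚ
      ≤⟨ ℚ.+-monoˡ-≤ ∣ c ∣ℚ (ℚ.<⇒≤ (close m N N≤m ℕ.≤-refl)) ⟩
    1ℚ + ∣ c ∣ℚ ∎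
  where
  open ℚ.≤-Reasoning
  c = seq x N

_*ᴿ_ : ℝ → ℝ → ℝ
(x *ᴿ y) .seq m = seq x m * seq y m
(x *ᴿ y) .cauchy = λ ε 0<ε →
  let K , 0<K , M₁ , x≤K = eventually-bounded x
      L , 0<L , N₁ , y≤L = eventually-bounded y
      η , 0<η , eq = split ε (K + L) 0<ε (ℚ.+-mono-< 0<K 0<L)
      M₂ , x-close = cauchy x η 0<η
      N₂ , y-close = cauchy y η 0<η
      M = M₁ ℕ.⊔ M₂
      N = N₁ ℕ.⊔ N₂
  in M ℕ.⊔ N , λ m n M⊔N≤m M⊔N≤n →
    let open ℚ.≤-Reasoning
        M≤m = ℕ.m⊔n≤o⇒m≤o M N M⊔N≤m
        N≤m = ℕ.m⊔n≤o⇒n≤o M N M⊔N≤m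
        M≤n = ℕ.m⊔n≤o⇒m≤o M N M⊔N≤n
        N≤n = ℕ.m⊔n≤o⇒n≤o M N M⊔N≤n
        a = seq x m ; b = seq y m ; c = seq x n ; d = seq y n
        bd<η = y-close m n (ℕ.m⊔n≤o⇒n≤o N₁ N₂ N≤m) (ℕ.m⊔n≤o⇒n≤o N₁ N₂ N≤n)
        ac<η = x-close m n (ℕ.m⊔n≤o⇒n≤o M₁ M₂ M≤m) (ℕ.m⊔n≤o⇒n≤o M₁ M₂ M≤n)
        instance
          _ = positive 0<K
          _ = positive 0<L
    in begin-strict
      ∣ a * b - c * d ∣ℚ
        ≡⟨ cong ∣_∣ℚ (solve 4 (λ a b c d → a :* b :- c :* d := a :* (b :- d) :+ d :* (a :- c)) refl a b c d) ⟩
      ∣ a * (b - d) + d * (a - c) ∣ℚ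
        ≤⟨ ℚ.∣p+q∣≤∣p∣+∣q∣ (a * (b - d)) (d * (a - c)) ⟩
      ∣ a * (b - d) ∣ℚ + ∣ d * (a - c) ∣ℚ
        ≡⟨ cong₂ _+_ (ℚ.∣p*q∣≡∣p∣*∣q∣ a (b - d)) (ℚ.∣p*q∣≡∣p∣*∣q∣ d (a - c)) ⟩
      ∣ a ∣ℚ * ∣ b - d ∣ℚ + ∣ d ∣ℚ * ∣ a - c ∣ℚ
        ≤⟨ ℚ.+-mono-≤
             (ℚ.*-monoʳ-≤-nonNeg ∣ b - d ∣ℚ {{ℚ.∣-∣-nonNeg (b - d)}} (x≤K m (ℕ.m⊔n≤o⇒m≤o M₁ M₂ M≤m)))
             (ℚ.*-monoʳ-≤-nonNeg ∣ a - c ∣ℚ {{ℚ.∣-∣-nonNeg (a - c)}} (y≤L n (ℕ.m⊔n≤o⇒m≤o N₁ N₂ N≤n))) ⟩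
      K * ∣ b - d ∣ℚ + L * ∣ a - c ∣ℚ
        <⟨ ℚ.+-mono-< (ℚ.*-monoʳ-<-pos K bd<η) (ℚ.*-monoʳ-<-pos L ac<η) ⟩
      K * η + L * η
        ≡⟨ ℚ.*-distribʳ-+ η K L ⟨
      (K + L) * η
        ≡⟨ eq ⟩
      ε ∎

-- Total reciprocal. The value at 0 is arbitrary: the sequence of a positive
-- real eventually stays away from 0.
inv : ℚ → ℚ
inv p with p ℚ.≟ 0ℚ
... | yes _  = 0ℚ
... | no p≢0 = (1/ p) {{≢-nonZero p≢0}}

inv-pos : ∀ {p} → 0ℚ < p → 0ℚ < inv p × p * inv p ≡ 1ℚ
inv-pos {p} 0<p with p ℚ.≟ 0ℚ
... | yes p≡0 = contradiction (sym p≡0) (ℚ.<⇒≢ 0<p)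
... | no p≢0  =
  ℚ.positive⁻¹ _ {{ℚ.1/pos⇒pos p {{positive 0<p}}}} , ℚ.*-inverseʳ p {{≢-nonZero p≢0}}

_⁻¹ᴿ : (x : ℝ) {{_ : Positiveᴿ x}} → ℝ
(x ⁻¹ᴿ) .seq m = inv (seq x m)
_⁻¹ᴿ x {{x>0}} .cauchy = λ ε 0<ε →
  let η = ε * (c * c)
      0<cc = *-pos c>0 c>0
      N , close = cauchy x η (*-pos 0<ε 0<cc)
  in M ℕ.⊔ N , λ m n M⊔N≤m M⊔N≤n →
    let open ℚ.≤-Reasoning
        a = seq x m ; b = seq x n ; u = inv a ; v = inv b
        c≤a = above m (ℕ.m⊔n≤o⇒m≤o M N M⊔N≤m)
        c≤b = above n (ℕ.m⊔n≤o⇒m≤o M N M⊔N≤n)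
        0<u , au≡1 = inv-pos (ℚ.<-≤-trans c>0 c≤a)
        0<v , bv≡1 = inv-pos (ℚ.<-≤-trans c>0 c≤b)
        0<uv = *-pos 0<u 0<v
        cu≤1 = subst (c * u ≤_) au≡1 (ℚ.*-monoʳ-≤-nonNeg u {{nonNegative (ℚ.<⇒≤ 0<u)}} c≤a)
        cv≤1 = subst (c * v ≤_) bv≡1 (ℚ.*-monoʳ-≤-nonNeg v {{nonNegative (ℚ.<⇒≤ 0<v)}} c≤b)
    in begin-strict
      ∣ u - v ∣ℚ
        ≡⟨ cong ∣_∣ℚ (cong₂ _-_
             (trans (sym (ℚ.*-identityʳ u)) (cong (u *_) (sym bv≡1)))
             (trans (sym (ℚ.*-identityʳ v)) (cong (v *_) (sym au≡1)))) ⟩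
      ∣ u * (b * v) - v * (a * u) ∣ℚ
        ≡⟨ cong ∣_∣ℚ (solve 4 (λ a b u v → u :* (b :* v) :- v :* (a :* u) := (b :- a) :* (u :* v)) refl a b u v) ⟩
      ∣ (b - a) * (u * v) ∣ℚ
        ≡⟨ ℚ.∣p*q∣≡∣p∣*∣q∣ (b - a) (u * v) ⟩
      ∣ b - a ∣ℚ * ∣ u * v ∣ℚ
        ≡⟨ cong (∣ b - a ∣ℚ *_) (ℚ.0≤p⇒∣p∣≡p (ℚ.<⇒≤ 0<uv)) ⟩
      ∣ b - a ∣ℚ * (u * v)
        <⟨ ℚ.*-monoˡ-<-pos (u * v) {{positive 0<uv}}
             (close n m (ℕ.m⊔n≤o⇒n≤o M N M⊔N≤n) (ℕ.m⊔n≤o⇒n≤o M N M⊔N≤m)) ⟩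
      ε * (c * c) * (u * v)
        ≡⟨ solve 4 (λ ε c u v → ε :* (c :* c) :* (u :* v) := ε :* ((c :* u) :* (c :* v))) refl ε c u v ⟩
      ε * ((c * u) * (c * v))
        ≤⟨ ℚ.*-monoˡ-≤-nonNeg ε {{nonNegative (ℚ.<⇒≤ 0<ε)}}
             (*-mono-≤ (ℚ.<⇒≤ (*-pos c>0 0<v)) (ℚ.<⇒≤ (ℚ.positive⁻¹ 1ℚ)) cu≤1 cv≤1) ⟩
      ε * (1ℚ * 1ℚ)
        ≡⟨ ℚ.*-identityʳ ε ⟩
      ε ∎
  where open Positiveᴿ x>0 renaming (bound to c; bound>0 to c>0; threshold to M)

_÷ᴿ_ : (x y : ℝ) {{_ : Positiveᴿ y}} → ℝ
x ÷ᴿ y = x *ᴿ y ⁻¹ᴿ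

instance
  *ᴿ-positive : ∀ {x y} {{_ : Positiveᴿ x}} {{_ : Positiveᴿ y}} → Positiveᴿ (x *ᴿ y)
  *ᴿ-positive {x} {y} {{x>0}} {{y>0}} = record
    { bound     = X.bound * Y.bound
    ; bound>0   = *-pos X.bound>0 Y.bound>0
    ; threshold = X.threshold ℕ.⊔ Y.threshold
    ; above     = λ m ≤m →
        let X≤ = X.above m (ℕ.m⊔n≤o⇒m≤o X.threshold Y.threshold ≤m)
            Y≤ = Y.above m (ℕ.m⊔n≤o⇒n≤o X.threshold Y.threshold ≤m)
        in *-mono-≤ (ℚ.<⇒≤ Y.bound>0) (ℚ.≤-trans (ℚ.<⇒≤ X.bound>0) X≤) X≤ Y≤
    }
    where
    module X = Positiveᴿ x>0
    module Y = Positiveᴿ y>0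

rootBelow : ℕ → ℕ → ℕ → ℕ
rootBelow q a zero    = zero
rootBelow q a (suc t) with suc t ℕ.^ q ℕ.≤? a
... | yes _ = suc t
... | no  _ = rootBelow q a t

rootBelow-greatest : ∀ q a t {s} → s ℕ.≤ t → s ℕ.^ q ℕ.≤ a → s ℕ.≤ rootBelow q a t
rootBelow-greatest q a zero    s≤t s^q≤a = s≤t
rootBelow-greatest q a (suc t) s≤t s^q≤a with suc t ℕ.^ q ℕ.≤? a
... | yes _ = s≤t
... | no ¬p with ℕ.m≤n⇒m<n∨m≡n s≤t
...   | inj₁ (s≤s s≤t′) = rootBelow-greatest q a t s≤t′ s^q≤a
...   | inj₂ refl       = contradiction s^q≤a ¬p

rootBelow-sound : ∀ q .{{_ : ℕ.NonZero q}} a t → rootBelow q a t ℕ.^ q ℕ.≤ a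
rootBelow-sound (suc q) a zero    = z≤n
rootBelow-sound q       a (suc t) with suc t ℕ.^ q ℕ.≤? a
... | yes p = p
... | no  _ = rootBelow-sound q a t

m≤m^q : ∀ m q .{{_ : ℕ.NonZero q}} → m ℕ.≤ m ℕ.^ q
m≤m^q zero      q       = z≤n
m≤m^q m@(suc _) (suc q) = ℕ.m≤m*n m (m ℕ.^ q) {{ℕ.m^n≢0 m q}}

^-distribʳ-* : ∀ m n q → (m ℕ.* n) ℕ.^ q ≡ m ℕ.^ q ℕ.* n ℕ.^ q
^-distribʳ-* m n zero    = refl
^-distribʳ-* m n (suc q) =
  trans (cong (m ℕ.* n ℕ.*_) (^-distribʳ-* m n q)) (ℕ.[m*n]*[o*p]≡[m*o]*[n*p] m n (m ℕ.^ q) (n ℕ.^ q))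

^-cancelʳ-< : ∀ q {m n} → m ℕ.^ q ℕ.< n ℕ.^ q → m ℕ.< n
^-cancelʳ-< q m^q<n^q = ℕ.≰⇒> λ n≤m → ℕ.<⇒≱ m^q<n^q (ℕ.^-monoˡ-≤ q n≤m)

⌊_^1/_⌋ : ℕ → ℕ → ℕ
⌊ a ^1/ q ⌋ = rootBelow q a a

⌊^1/⌋-sound : ∀ a q .{{_ : ℕ.NonZero q}} → ⌊ a ^1/ q ⌋ ℕ.^ q ℕ.≤ a
⌊^1/⌋-sound a q = rootBelow-sound q a a

⌊^1/⌋-greatest : ∀ a q .{{_ : ℕ.NonZero q}} {s} → s ℕ.^ q ℕ.≤ a → s ℕ.≤ ⌊ a ^1/ q ⌋
⌊^1/⌋-greatest a q {s} s^q≤a = rootBelow-greatest q a a (ℕ.≤-trans (m≤m^q s q) s^q≤a) s^q≤a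

⌊^1/⌋-upper : ∀ a q .{{_ : ℕ.NonZero q}} → a ℕ.< suc ⌊ a ^1/ q ⌋ ℕ.^ q
⌊^1/⌋-upper a q = ℕ.≰⇒> λ le → ℕ.<-irrefl refl (⌊^1/⌋-greatest a q le)

-- With d = m + 1 this is ⌊ d · a ^ (1 / q) ⌋ / d, which is within 1 / d of
-- a ^ (1 / q).
approx : ℕ → ℕ → ℕ → ℚ
approx a q m = + ⌊ a ℕ.* suc m ℕ.^ q ^1/ q ⌋ / suc m

/-mono-< : ∀ a b c d .{{_ : ℕ.NonZero b}} .{{_ : ℕ.NonZero d}} →
           a ℕ.* d ℕ.< c ℕ.* b → + a / b < + c / d
/-mono-< a (suc b) c (suc d) ad<cb = ℚ.toℚᵘ-cancel-< (begin-strict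
  toℚᵘ (+ a / suc b)  ≃⟨ ℚ.toℚᵘ-fromℚᵘ (mkℚᵘ (+ a) b) ⟩
  mkℚᵘ (+ a) b        <⟨ ℚᵘ.*<* (subst₂ ℤ._<_ (ℤ.pos-* a (suc d)) (ℤ.pos-* c (suc b)) (ℤ.+<+ ad<cb)) ⟩
  mkℚᵘ (+ c) d        ≃⟨ ℚ.toℚᵘ-fromℚᵘ (mkℚᵘ (+ c) d) ⟨
  toℚᵘ (+ c / suc d)  ∎)
  where open ℚᵘ.≤-Reasoning

[1+t]/d : ∀ t d .{{_ : ℕ.NonZero d}} → + suc t / d ≡ + 1 / d + + t / d
[1+t]/d t d@(suc d-1) = ℚ.toℚᵘ-injective (begin
  toℚᵘ (+ suc t / d)                    ≈⟨ ℚ.toℚᵘ-fromℚᵘ (mkℚᵘ (+ suc t) d-1) ⟩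
  mkℚᵘ (+ suc t) d-1                    ≈⟨ ℚᵘ.*≡* eq ⟩
  mkℚᵘ (+ 1) d-1 ℚᵘ.+ mkℚᵘ (+ t) d-1    ≈⟨ ℚᵘ.+-cong (ℚ.toℚᵘ-fromℚᵘ (mkℚᵘ (+ 1) d-1)) (ℚ.toℚᵘ-fromℚᵘ (mkℚᵘ (+ t) d-1)) ⟨
  toℚᵘ (+ 1 / d) ℚᵘ.+ toℚᵘ (+ t / d)    ≈⟨ ℚ.toℚᵘ-homo-+ (+ 1 / d) (+ t / d) ⟨
  toℚᵘ (+ 1 / d + + t / d)              ∎)
  where
  open ≈-Reasoning ℚᵘ.≃-setoid
  eq : + suc t ℤ.* (+ d ℤ.* + d) ≡ (+ 1 ℤ.* + d ℤ.+ + t ℤ.* + d) ℤ.* + d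
  eq = trans (sym (ℤ.*-assoc (+ suc t) (+ d) (+ d)))
             (cong (ℤ._* + d) (ℤ.*-distribʳ-+ (+ d) (+ 1) (+ t)))

approx-close : ∀ a q .{{_ : ℕ.NonZero q}} m n →
               approx a q m - approx a q n < + 1 / suc n
approx-close a q m n = p<r+q⇒p-q<r (approx a q m) (approx a q n) (+ 1 / suc n)
  (subst (approx a q m <_) ([1+t]/d t (suc n)) (/-mono-< s (suc m) (suc t) (suc n) sn<tm))
  where
  M = suc m
  N = suc n
  s = ⌊ a ℕ.* M ℕ.^ q ^1/ q ⌋
  t = ⌊ a ℕ.* N ℕ.^ q ^1/ q ⌋
  sn<tm : s ℕ.* N ℕ.< suc t ℕ.* M
  sn<tm = ^-cancelʳ-< q (begin-strict
    (s ℕ.* N) ℕ.^ q               ≡⟨ ^-distribʳ-* s N q ⟩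
    s ℕ.^ q ℕ.* N ℕ.^ q           ≤⟨ ℕ.*-monoˡ-≤ (N ℕ.^ q) (⌊^1/⌋-sound (a ℕ.* M ℕ.^ q) q) ⟩
    a ℕ.* M ℕ.^ q ℕ.* N ℕ.^ q     ≡⟨ ℕ.*-assoc a (M ℕ.^ q) (N ℕ.^ q) ⟩
    a ℕ.* (M ℕ.^ q ℕ.* N ℕ.^ q)   ≡⟨ cong (a ℕ.*_) (ℕ.*-comm (M ℕ.^ q) (N ℕ.^ q)) ⟩
    a ℕ.* (N ℕ.^ q ℕ.* M ℕ.^ q)   ≡⟨ ℕ.*-assoc a (N ℕ.^ q) (M ℕ.^ q) ⟨
    a ℕ.* N ℕ.^ q ℕ.* M ℕ.^ q     <⟨ ℕ.*-monoˡ-< (M ℕ.^ q) {{ℕ.m^n≢0 M q}} (⌊^1/⌋-upper (a ℕ.* N ℕ.^ q) q) ⟩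
    suc t ℕ.^ q ℕ.* M ℕ.^ q       ≡⟨ ^-distribʳ-* (suc t) M q ⟨
    (suc t ℕ.* M) ℕ.^ q           ∎)
    where open ℕ.≤-Reasoning

archimedean : ∀ ε → 0ℚ < ε → ∃[ N ] (∀ n → N ℕ.≤ n → + 1 / suc n < ε)
archimedean ε 0<ε = ↧ₙ ε , λ n N≤n →
  subst (+ 1 / suc n <_) (ℚ.↥p/↧p≡p ε) (1/n<ε ε (positive 0<ε) n N≤n)
  where
  1/n<ε : ∀ ε → Positive ε → ∀ n → ↧ₙ ε ℕ.≤ n → + 1 / suc n < ↥ ε / ↧ₙ ε
  1/n<ε (mkℚ +[1+ p ] d _) _ n d<n = /-mono-< 1 (suc n) (suc p) (suc d) (begin-strict
    1 ℕ.* suc d      ≡⟨ ℕ.*-identityˡ (suc d) ⟩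
    suc d            <⟨ s≤s d<n ⟩
    suc n            ≤⟨ ℕ.m≤n*m (suc n) (suc p) ⟩
    suc p ℕ.* suc n  ∎)
    where open ℕ.≤-Reasoning

-- a ^ (p / q) is the q-th root of a ^ p.
_^ᴿ_ : (a : ℕ) (r : ℚᵘ) {{_ : ℚᵘ.NonNegative r}} → ℝ
(a ^ᴿ r) .seq = approx (a ℕ.^ ℤ.∣ ℚᵘ.↥ r ∣) (ℚᵘ.↧ₙ r)
(a ^ᴿ r) .cauchy = λ ε 0<ε →
  let N , small = archimedean ε 0<ε
  in N , λ m n N≤m N≤n → ∣p∣<r
    (ℚ.<-trans (approx-close b q m n) (small n N≤n))
    (subst (_< ε) (solve 2 (λ x y → y :- x := :- (x :- y)) refl (approx b q m) (approx b q n))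
      (ℚ.<-trans (approx-close b q n m) (small m N≤m)))
  where
  q = ℚᵘ.↧ₙ r
  b = a ℕ.^ ℤ.∣ ℚᵘ.↥ r ∣

instance
  ^ᴿ-positive : ∀ {a r} .{{_ : ℕ.NonZero a}} {{_ : ℚᵘ.NonNegative r}} → Positiveᴿ (a ^ᴿ r)
  ^ᴿ-positive {a} {r} = record
    { bound     = + 1 / 2
    ; bound>0   = ℚ.positive⁻¹ (+ 1 / 2)
    ; threshold = 0
    ; above     = λ m _ → ℚ.<⇒≤ (/-mono-< 1 2 ⌊ b ℕ.* suc m ℕ.^ q ^1/ q ⌋ (suc m) (above m))
    }
    where
    q = ℚᵘ.↧ₙ r
    b = a ℕ.^ ℤ.∣ ℚᵘ.↥ r ∣
    above : ∀ m → 1 ℕ.* suc m ℕ.< ⌊ b ℕ.* suc m ℕ.^ q ^1/ q ⌋ ℕ.* 2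
    above m = begin-strict
      1 ℕ.* M                           ≡⟨ ℕ.*-identityˡ M ⟩
      M                                 <⟨ ℕ.m<m*n M 2 (s≤s (s≤s z≤n)) ⟩
      M ℕ.* 2                           ≤⟨ ℕ.*-monoˡ-≤ 2 (⌊^1/⌋-greatest (b ℕ.* M ℕ.^ q) q
                                             (ℕ.m≤n*m (M ℕ.^ q) b {{ℕ.m^n≢0 a ℤ.∣ ℚᵘ.↥ r ∣}})) ⟩
      ⌊ b ℕ.* M ℕ.^ q ^1/ q ⌋ ℕ.* 2     ∎
      where
      open ℕ.≤-Reasoning
      M = suc m

C-nonZero : ∀ {n k} → k ℕ.≤ n → ℕ.NonZero (n C k)
C-nonZero {n}     {zero}  _         = _
C-nonZero {suc n} {suc k} (s≤s k≤n) = ℕ.>-nonZero (begin-strict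
  0                        <⟨ ℕ.>-nonZero⁻¹ (n C k) {{C-nonZero k≤n}} ⟩
  n C k                    ≤⟨ ℕ.m≤m+n (n C k) (n C suc k) ⟩
  n C k ℕ.+ n C suc k      ≡⟨ nCk+nC[k+1]≡[n+1]C[k+1] n k ⟩
  suc n C suc k            ∎)
  where open ℕ.≤-Reasoning

k∸1≤ : ∀ {k n} → k ℕ.≤ n → k ℕ.∸ 1 ℕ.≤ n
k∸1≤ {k} k≤n = ℕ.≤-trans (ℕ.m∸n≤m k 1) k≤n

{-# OPTIONS --safe #-}
-- Put m = δ − k + 1 and b = C(δ, k − 1), and let X contain each vertex independently
-- with probability 1 − q. A vertex lies outside X and has fewer than k in-neighbours
-- in X with probability at most b q ^ (m + 1), so adding all such vertices to X gives
-- a k-dominating set of mean size at most (1 − q + b q ^ (m + 1)) n. The optimal q,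
-- given by b (1 + m) q ^ m = 1, yields the bound. It is irrational, so q is rounded
-- down to (1 + m) / ((β + η) (σ + η)), where β and σ are the approximations from below,
-- with error less than η, to the two roots in the theorem; letting η tend to 0 loses
-- nothing. For rational q the means are weighted counts in ℕ.
module Submission where

open import Defs

-- Cardinalities of subsets, and expectations as weighted counts in ℕ.

module Averaging where

  open import Data.Bool.Base using (Bool; true; false; if_then_else_; T; not; _∧_)
  open import Data.Fin.Base using (Fin; zero; suc)
  open import Data.Fin.Subset
  open import Data.Fin.Subset.Properties using (p⊆q⇒∣p∣≤∣q∣; p⊆p∪q; q⊆p∪q; x∈p∩q⁺; x∈p∩q⁻)
  open import Data.List.Extrema.Nat using (min≤xs)
  open import Data.List.Membership.Propositional.Properties using (∈-map⁺; ∈-allFin)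
  import Data.List.Relation.Unary.All as All
  open import Data.Nat.Base
  open import Data.Nat.Combinatorics using (_C_; nCn≡1; nCk+nC[k+1]≡[n+1]C[k+1])
  open import Data.Nat.Properties as ℕ hiding (*-mono-≤)
  open import Data.Nat.Solver using (module +-*-Solver)
  open import Data.Product.Base using (∃-syntax; _,_)
  open import Data.Sum.Base using (inj₁; inj₂)
  open import Data.Vec.Base using ([]; _∷_; lookup; tabulate; _[_]≔_)
  open import Data.Vec.Properties using (lookup⇒[]=; lookup∘tabulate)
  open import Function.Base using (_∘_; it)
  open import Relation.Binary.PropositionalEquality
  open import Relation.Nullary.Decidable using (dec-false)

  open +-*-Solver using (solve; _:+_; _:*_; _:=_; con)

  ⟦_⟧ : Bool → ℕ
  ⟦ b ⟧ = if b then 1 else 0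

  ⟦⟧≤1 : ∀ b → ⟦ b ⟧ ≤ 1
  ⟦⟧≤1 true  = ≤-refl
  ⟦⟧≤1 false = z≤n

  ∣b∷p∣≡⟦b⟧+∣p∣ : ∀ {n} b (p : Subset n) → ∣ b ∷ p ∣ ≡ ⟦ b ⟧ + ∣ p ∣
  ∣b∷p∣≡⟦b⟧+∣p∣ true  p = refl
  ∣b∷p∣≡⟦b⟧+∣p∣ false p = refl

  ∣p∪q∣≤∣p∣+∣q∣ : ∀ {n} (p q : Subset n) → ∣ p ∪ q ∣ ≤ ∣ p ∣ + ∣ q ∣
  ∣p∪q∣≤∣p∣+∣q∣ []            []            = z≤n
  ∣p∪q∣≤∣p∣+∣q∣ (outside ∷ p) (outside ∷ q) = ∣p∪q∣≤∣p∣+∣q∣ p q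
  ∣p∪q∣≤∣p∣+∣q∣ (outside ∷ p) (inside  ∷ q) =
    ≤-trans (s≤s (∣p∪q∣≤∣p∣+∣q∣ p q)) (≤-reflexive (sym (+-suc ∣ p ∣ ∣ q ∣)))
  ∣p∪q∣≤∣p∣+∣q∣ (inside  ∷ p) (outside ∷ q) = s≤s (∣p∪q∣≤∣p∣+∣q∣ p q)
  ∣p∪q∣≤∣p∣+∣q∣ (inside  ∷ p) (inside  ∷ q) =
    s≤s (≤-trans (∣p∪q∣≤∣p∣+∣q∣ p q) (+-monoʳ-≤ ∣ p ∣ (n≤1+n ∣ q ∣)))

  ∩-monoʳ-∣∣ : ∀ {n} (s : Subset n) {p q} → p ⊆ q → ∣ s ∩ p ∣ ≤ ∣ s ∩ q ∣
  ∩-monoʳ-∣∣ s {p} p⊆q = p⊆q⇒∣p∣≤∣q∣ λ x∈s∩p →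
    let x∈s , x∈p = x∈p∩q⁻ s p x∈s∩p in x∈p∩q⁺ (x∈s , p⊆q x∈p)

  -- Applied to an in-neighbourhood, this gives the independence that `total-avoid` needs: the
  -- number of in-neighbours of v in X does not depend on whether v is in X.
  outside-∩ : ∀ {n} (s : Subset n) v → lookup s v ≡ outside → ∀ X b →
              ∣ s ∩ (X [ v ]≔ b) ∣ ≡ ∣ s ∩ X ∣
  outside-∩ (outside ∷ s) zero    _   (_ ∷ X) b = refl
  outside-∩ (x ∷ s)       (suc v) s∌v (y ∷ X) b = begin
    ∣ (x ∧ y) ∷ (s ∩ (X [ v ]≔ b)) ∣       ≡⟨ ∣b∷p∣≡⟦b⟧+∣p∣ (x ∧ y) (s ∩ (X [ v ]≔ b)) ⟩
    ⟦ x ∧ y ⟧ + ∣ s ∩ (X [ v ]≔ b) ∣       ≡⟨ cong (⟦ x ∧ y ⟧ +_) (outside-∩ s v s∌v X b) ⟩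
    ⟦ x ∧ y ⟧ + ∣ s ∩ X ∣                  ≡⟨ ∣b∷p∣≡⟦b⟧+∣p∣ (x ∧ y) (s ∩ X) ⟨
    ∣ (x ∧ y) ∷ (s ∩ X) ∣                  ∎
    where open ≡-Reasoning

  -- Divided by (a + c) ^ n, this is the expectation of f at a random subset
  -- that contains each element independently with probability a / (a + c).
  total : ∀ {n} (a c : ℕ) → (Subset n → ℕ) → ℕ
  total {zero}  a c f = f []
  total {suc n} a c f = a * total a c (f ∘ (inside ∷_)) + c * total a c (f ∘ (outside ∷_))

  module _ (a c : ℕ) where

    open ≤-Reasoning

    R : ℕ
    R = a + c

    total-mono : ∀ {n} {f g : Subset n → ℕ} → (∀ X → f X ≤ g X) → total a c f ≤ total a c g
    total-mono {zero}  f≤g = f≤g []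
    total-mono {suc n} f≤g = +-mono-≤
      (*-monoʳ-≤ a (total-mono (f≤g ∘ (inside ∷_))))
      (*-monoʳ-≤ c (total-mono (f≤g ∘ (outside ∷_))))

    total-cong : ∀ {n} {f g : Subset n → ℕ} → (∀ X → f X ≡ g X) → total a c f ≡ total a c g
    total-cong f≡g = ≤-antisym
      (total-mono (≤-reflexive ∘ f≡g))
      (total-mono (≤-reflexive ∘ sym ∘ f≡g))

    total-+ : ∀ {n} (f g : Subset n → ℕ) →
              total a c (λ X → f X + g X) ≡ total a c f + total a c g
    total-+ {zero}  f g = refl
    total-+ {suc n} f g = trans
      (cong₂ (λ x y → a * x + c * y)
        (total-+ (f ∘ (inside ∷_)) (g ∘ (inside ∷_)))
        (total-+ (f ∘ (outside ∷_)) (g ∘ (outside ∷_))))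
      (solve 6 (λ a c x y z w → a :* (x :+ y) :+ c :* (z :+ w) := (a :* x :+ c :* z) :+ (a :* y :+ c :* w))
        refl a c _ _ _ _)

    total-const : ∀ n k → total {n} a c (λ _ → k) ≡ k * R ^ n
    total-const zero    k = sym (*-identityʳ k)
    total-const (suc n) k = trans
      (cong (λ x → a * x + c * x) (total-const n k))
      (solve 4 (λ a c k r → a :* (k :* r) :+ c :* (k :* r) := k :* ((a :+ c) :* r)) refl a c k (R ^ n))

    mean-step : ∀ x {r s t} → x * r ≤ s → x * r ≤ t → x * (R * r) ≤ a * s + c * t
    mean-step x {r} {s} {t} xr≤s xr≤t = begin
      x * (R * r)                  ≡⟨ solve 4 (λ a c x r → x :* ((a :+ c) :* r) := a :* (x :* r) :+ c :* (x :* r)) refl a c x r ⟩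
      a * (x * r) + c * (x * r)    ≤⟨ +-mono-≤ (*-monoʳ-≤ a xr≤s) (*-monoʳ-≤ c xr≤t) ⟩
      a * s + c * t                ∎

    -- Method of conditional expectations: the total is a weighted sum of the totals of the two
    -- branches, so at each element the branch with the smaller total is followed.
    ∃≤mean : ∀ {n} (f : Subset n → ℕ) → ∃[ X ] f X * R ^ n ≤ total a c f
    ∃≤mean {zero}  f = [] , ≤-reflexive (*-identityʳ (f []))
    ∃≤mean {suc n} f
      with X , fX≤ ← ∃≤mean (f ∘ (inside ∷_))
         | Y , fY≤ ← ∃≤mean (f ∘ (outside ∷_))
      with ≤-total (total a c (f ∘ (inside ∷_))) (total a c (f ∘ (outside ∷_)))
    ... | inj₁ in≤out = inside ∷ X , mean-step (f (inside ∷ X)) fX≤ (≤-trans fX≤ in≤out)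
    ... | inj₂ out≤in = outside ∷ Y , mean-step (f (outside ∷ Y)) (≤-trans fY≤ out≤in) fY≤

    -- Linearity of expectation, each element being present with probability a / R. The extra factor
    -- R on the left avoids the exponent n - 1.
    total-∣∣ : ∀ n → total {n} a c ∣_∣ * R ≡ n * a * R ^ n
    total-∣∣ zero    = refl
    total-∣∣ (suc n) = begin-equality
      (a * total {n} a c (λ X → 1 + ∣ X ∣) + c * s) * R
        ≡⟨ cong (λ x → (a * x + c * s) * R) (trans (total-+ {n} (λ _ → 1) ∣_∣) (cong (_+ s) (total-const n 1))) ⟩
      (a * (1 * R ^ n + s) + c * s) * R
        ≡⟨ solve 4 (λ a c r s → (a :* (con 1 :* r :+ s) :+ c :* s) :* (a :+ c)
             := a :* ((a :+ c) :* r) :+ (a :+ c) :* (s :* (a :+ c))) refl a c (R ^ n) s ⟩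
      a * R ^ suc n + R * (s * R)
        ≡⟨ cong (λ x → a * R ^ suc n + R * x) (total-∣∣ n) ⟩
      a * R ^ suc n + R * (n * a * R ^ n)
        ≡⟨ solve 4 (λ a c r n → a :* ((a :+ c) :* r) :+ (a :+ c) :* (n :* a :* r)
             := (a :+ n :* a) :* ((a :+ c) :* r)) refl a c (R ^ n) n ⟩
      suc n * a * R ^ suc n ∎
      where s = total {n} a c ∣_∣

    -- Linearity of expectation for the number of events that occur, out of m events with a common
    -- bound l / k on their totals. The events need not be independent.
    total-tabulate : ∀ {n} m (b : Fin m → Subset n → Bool) {k l} →
                     (∀ v → total a c (λ X → ⟦ b v X ⟧) * k ≤ l) →
                     total a c (λ X → ∣ tabulate (λ v → b v X) ∣) * k ≤ m * l
    total-tabulate {n} zero    b {k} _  = ≤-reflexive (cong (_* k) (total-const n 0))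
    total-tabulate     (suc m) b {k} {l} le = begin
      total a c (λ X → ∣ tabulate (λ v → b v X) ∣) * k
        ≡⟨ cong (_* k) (total-cong λ X → ∣b∷p∣≡⟦b⟧+∣p∣ (b zero X) (tabulate (λ v → b (suc v) X))) ⟩
      total a c (λ X → ⟦ b zero X ⟧ + ∣ tabulate (λ v → b (suc v) X) ∣) * k
        ≡⟨ cong (_* k) (total-+ (λ X → ⟦ b zero X ⟧) (λ X → ∣ tabulate (λ v → b (suc v) X) ∣)) ⟩
      (total a c (λ X → ⟦ b zero X ⟧) + total a c (λ X → ∣ tabulate (λ v → b (suc v) X) ∣)) * k
        ≡⟨ *-distribʳ-+ k (total a c (λ X → ⟦ b zero X ⟧)) _ ⟩
      total a c (λ X → ⟦ b zero X ⟧) * k + total a c (λ X → ∣ tabulate (λ v → b (suc v) X) ∣) * k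
        ≤⟨ +-mono-≤ (le zero) (total-tabulate m (b ∘ suc) (le ∘ suc)) ⟩
      l + m * l ∎

    -- By hypothesis h ignores coordinate v, so it is independent of the event that v is left out,
    -- which has probability c / R.
    total-avoid : ∀ {n} (v : Fin n) (h : Subset n → Bool) →
                  (∀ X → h (X [ v ]≔ inside) ≡ h (X [ v ]≔ outside)) →
                  total a c (λ X → ⟦ not (lookup X v) ∧ h X ⟧) * R ≡ c * total a c (λ X → ⟦ h X ⟧)
    total-avoid {suc n} zero h inv = begin-equality
      (a * total {n} a c (λ _ → 0) + c * s) * R   ≡⟨ cong (λ x → (a * x + c * s) * R) (total-const n 0) ⟩
      (a * 0 + c * s) * R                         ≡⟨ solve 3 (λ a c s → (a :* con 0 :+ c :* s) :* (a :+ c) := c :* (a :* s :+ c :* s)) refl a c s ⟩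
      c * (a * s + c * s)                         ≡⟨ cong (λ x → c * (a * x + c * s)) (total-cong λ X → cong ⟦_⟧ (inv (inside ∷ X))) ⟨
      c * total a c (λ X → ⟦ h X ⟧)               ∎
      where s = total a c (λ X → ⟦ h (outside ∷ X) ⟧)
    total-avoid (suc v) h inv = begin-equality
      (a * s + c * t) * R        ≡⟨ solve 4 (λ a c s t → (a :* s :+ c :* t) :* (a :+ c) := a :* (s :* (a :+ c)) :+ c :* (t :* (a :+ c))) refl a c s t ⟩
      a * (s * R) + c * (t * R)  ≡⟨ cong₂ (λ x y → a * x + c * y)
                                      (total-avoid v (h ∘ (inside ∷_)) (inv ∘ (inside ∷_)))
                                      (total-avoid v (h ∘ (outside ∷_)) (inv ∘ (outside ∷_))) ⟩
      a * (c * s′) + c * (c * t′)  ≡⟨ solve 4 (λ a c s t → a :* (c :* s) :+ c :* (c :* t) := c :* (a :* s :+ c :* t)) refl a c s′ t′ ⟩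
      c * (a * s′ + c * t′)        ∎
      where
      s  = total a c (λ X → ⟦ not (lookup X v) ∧ h (inside ∷ X) ⟧)
      t  = total a c (λ X → ⟦ not (lookup X v) ∧ h (outside ∷ X) ⟧)
      s′ = total a c (λ X → ⟦ h (inside ∷ X) ⟧)
      t′ = total a c (λ X → ⟦ h (outside ∷ X) ⟧)

    few : ∀ {n} → ℕ → Subset n → Subset n → ℕ
    few k S X = ⟦ ∣ S ∩ X ∣ <ᵇ k ⟧

    -- The event that a random subset meets S in at most j elements has probability
    -- at most C(j + t, j) q ^ t with q = c / (a + c); the induction is Pascal's rule.
    total-few : ∀ {n} (S : Subset n) j t → j + t ≤ ∣ S ∣ →
                total a c (few (suc j) S) * R ^ t ≤ ((j + t) C j) * c ^ t * R ^ n
    total-few {n} S j zero _ = begin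
      total a c (few (suc j) S) * 1   ≤⟨ *-monoˡ-≤ 1 (total-mono λ X → ⟦⟧≤1 (∣ S ∩ X ∣ <ᵇ suc j)) ⟩
      total {n} a c (λ _ → 1) * 1     ≡⟨ *-identityʳ _ ⟩
      total {n} a c (λ _ → 1)         ≡⟨ total-const n 1 ⟩
      1 * R ^ n                       ≡⟨ cong (_* R ^ n) (trans (cong (_C j) (+-identityʳ j)) (nCn≡1 j)) ⟨
      ((j + 0) C j) * R ^ n             ≡⟨ cong (_* R ^ n) (*-identityʳ ((j + 0) C j)) ⟨
      ((j + 0) C j) * 1 * R ^ n         ∎
    total-few [] j (suc t) le with () ← ≤-trans (m≤n+m (suc t) j) le
    total-few {suc n} (outside ∷ S) j (suc t) le = begin
      (a * e + c * e) * R ^ suc t   ≡⟨ solve 4 (λ a c e r → (a :* e :+ c :* e) :* r := (a :+ c) :* (e :* r)) refl a c e (R ^ suc t) ⟩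
      R * (e * R ^ suc t)           ≤⟨ *-monoʳ-≤ R (total-few S j (suc t) le) ⟩
      R * (b * R ^ n)               ≡⟨ solve 3 (λ r b s → r :* (b :* s) := b :* (r :* s)) refl R b (R ^ n) ⟩
      b * (R * R ^ n)               ∎
      where
      e = total a c (few (suc j) S)
      b = ((j + suc t) C j) * c ^ suc t
    total-few {suc n} (inside ∷ S) zero (suc t) (s≤s le) = begin
      (a * total {n} a c (λ _ → 0) + c * e) * (R * R ^ t)   ≡⟨ cong (λ x → (a * x + c * e) * (R * R ^ t)) (total-const n 0) ⟩
      (a * 0 + c * e) * (R * R ^ t)   ≡⟨ solve 5 (λ a c e r s → (a :* con 0 :+ c :* e) :* (r :* s) := c :* r :* (e :* s)) refl a c e R (R ^ t) ⟩
      c * R * (e * R ^ t)             ≤⟨ *-monoʳ-≤ (c * R) (total-few S zero t le) ⟩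
      c * R * (1 * c ^ t * R ^ n)     ≡⟨ solve 4 (λ c r x y → c :* r :* (con 1 :* x :* y) := con 1 :* (c :* x) :* (r :* y)) refl c R (c ^ t) (R ^ n) ⟩
      1 * (c * c ^ t) * (R * R ^ n)   ∎
      where e = total a c (few 1 S)
    total-few {suc n} (inside ∷ S) (suc j) (suc t) (s≤s le) = begin
      (a * e + c * f) * (R * R ^ t)
        ≡⟨ solve 6 (λ a c e f r s → (a :* e :+ c :* f) :* (r :* s) := a :* (e :* (r :* s)) :+ c :* r :* (f :* s)) refl a c e f R (R ^ t) ⟩
      a * (e * R ^ suc t) + c * R * (f * R ^ t)
        -- If the new element of S is chosen, at most j of the others may be; if not, at most j + 1
        -- may be, with one factor c / R already gained. The weight a of the first case is enlarged
        -- to R so that both terms share the factors c ^ suc t and R ^ suc n, leaving Pascal's rule.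
        ≤⟨ +-mono-≤ (ℕ.*-mono-≤ (m≤m+n a c) (total-few S j (suc t) le))
                    (*-monoʳ-≤ (c * R) (total-few S (suc j) t (subst (_≤ ∣ S ∣) (+-suc j t) le))) ⟩
      R * (((j + suc t) C j) * c ^ suc t * R ^ n) + c * R * (((suc j + t) C suc j) * c ^ t * R ^ n)
        ≡⟨ cong (λ s → R * (((j + suc t) C j) * c ^ suc t * R ^ n) + c * R * ((s C suc j) * c ^ t * R ^ n)) (sym (+-suc j t)) ⟩
      R * (((j + suc t) C j) * c ^ suc t * R ^ n) + c * R * (((j + suc t) C suc j) * c ^ t * R ^ n)
        ≡⟨ solve 6 (λ c r x y z w → r :* (x :* (c :* z) :* w) :+ c :* r :* (y :* z :* w) := (x :+ y) :* (c :* z) :* (r :* w))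
             refl c R ((j + suc t) C j) ((j + suc t) C suc j) (c ^ t) (R ^ n) ⟩
      (((j + suc t) C j) + ((j + suc t) C suc j)) * c ^ suc t * R ^ suc n
        ≡⟨ cong (λ x → x * c ^ suc t * R ^ suc n) (nCk+nC[k+1]≡[n+1]C[k+1] (j + suc t) j) ⟩
      ((suc j + suc t) C suc j) * c ^ suc t * R ^ suc n ∎
      where
      e = total a c (few (suc j) S)
      f = total a c (few (suc (suc j)) S)

  -- Alteration: from a random subset of the vertices to a dominating set.

  module _ {n} (D : Digraph n) where

    open Digraph D

    δ⁻≤d⁻ : ∀ v → δ⁻ D ≤ d⁻ D v
    δ⁻≤d⁻ v = All.lookup (min≤xs n _) (∈-map⁺ (d⁻ D) (∈-allFin v))

    v∉N⁻v : ∀ v → lookup (N⁻ D v) v ≡ outside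
    v∉N⁻v v = trans (lookup∘tabulate _ v) (dec-false (arc? v v) (loopless v))

    undominated : ℕ → Subset n → Fin n → Bool
    undominated k X v = not (lookup X v) ∧ (∣ N⁻ D v ∩ X ∣ <ᵇ k)

    completion : ℕ → Subset n → Subset n
    completion k X = X ∪ tabulate (undominated k X)

    -- A vertex outside X with fewer than k in-neighbours in X has been added; one with at least k
    -- of them keeps these when X grows.
    completion-dominating : ∀ k X → Dominating D k (completion k X)
    completion-dominating k X v with lookup X v in Xv | ∣ N⁻ D v ∩ X ∣ <ᵇ k in lt
    ... | true  | _     = inj₁ (p⊆p∪q (tabulate (undominated k X)) (lookup⇒[]= v X Xv))
    ... | false | true  = inj₁ (q⊆p∪q X (tabulate (undominated k X))
      (lookup⇒[]= v _ (trans (lookup∘tabulate _ v) (cong₂ (λ x y → not x ∧ y) Xv lt))))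
    ... | false | false = inj₂ (≤-trans
      (≮⇒≥ λ N∩X<k → subst T lt (<⇒<ᵇ N∩X<k))
      (∩-monoʳ-∣∣ (N⁻ D v) (p⊆p∪q (tabulate (undominated k X)))))

    -- Some X is no worse than the mean of |X| plus the number of added vertices, taken with q = c /
    -- (a + c). In the exponent of c, t factors come from `total-few` and one from the vertex itself
    -- lying outside X.
    γ-bound : ∀ a c .{{_ : NonZero (a + c)}} j t → j + t ≡ δ⁻ D →
              γ (suc j) D * (a + c) ^ suc t ≤ n * (a * (a + c) ^ t + ((j + t) C j) * c ^ suc t)
    γ-bound a c j t j+t≡δ with X , fX≤ ← ∃≤mean a c (λ X → ∣ X ∣ + ∣ tabulate (undominated (suc j) X) ∣)
      = *-cancelʳ-≤ _ _ (r ^ n) {{m^n≢0 r n}} (begin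
        γ (suc j) D * r ^ suc t * r ^ n
          ≤⟨ *-monoˡ-≤ (r ^ n) (*-monoˡ-≤ (r ^ suc t) (≤-trans
               (γ-minimal (suc j) D _ (completion-dominating (suc j) X))
               (∣p∪q∣≤∣p∣+∣q∣ X (tabulate (undominated (suc j) X))))) ⟩
        f X * r ^ suc t * r ^ n
          ≡⟨ solve 3 (λ x y z → x :* y :* z := x :* z :* y) refl (f X) (r ^ suc t) (r ^ n) ⟩
        f X * r ^ n * r ^ suc t
          ≤⟨ *-monoˡ-≤ (r ^ suc t) fX≤ ⟩
        total a c f * r ^ suc t
          ≡⟨ cong (_* r ^ suc t) (total-+ a c ∣_∣ (λ X → ∣ tabulate (undominated (suc j) X) ∣)) ⟩
        (total {n} a c ∣_∣ + total a c (λ X → ∣ tabulate (undominated (suc j) X) ∣)) * r ^ suc t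
          ≡⟨ *-distribʳ-+ (r ^ suc t) (total {n} a c ∣_∣) _ ⟩
        total {n} a c ∣_∣ * (r * r ^ t) + total a c (λ X → ∣ tabulate (undominated (suc j) X) ∣) * r ^ suc t
          ≤⟨ +-mono-≤
               (≤-reflexive (trans (sym (*-assoc (total {n} a c ∣_∣) r (r ^ t))) (cong (_* r ^ t) (total-∣∣ a c n))))
               (total-tabulate a c n (λ v X → undominated (suc j) X v) undominated-bound) ⟩
        n * a * r ^ n * r ^ t + n * (b * c ^ suc t * r ^ n)
          ≡⟨ solve 6 (λ n a x y b z → n :* a :* x :* y :+ n :* (b :* z :* x) := n :* (a :* y :+ b :* z) :* x)
               refl n a (r ^ n) (r ^ t) b (c ^ suc t) ⟩
        n * (a * r ^ t + b * c ^ suc t) * r ^ n ∎)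
      where
      open ≤-Reasoning
      r = a + c
      b = (j + t) C j
      f : Subset n → ℕ
      f X = ∣ X ∣ + ∣ tabulate (undominated (suc j) X) ∣
      undominated-bound : ∀ v → total a c (λ X → ⟦ undominated (suc j) X v ⟧) * r ^ suc t ≤ b * c ^ suc t * r ^ n
      undominated-bound v = begin
        u * (r * r ^ t)     ≡⟨ *-assoc u r (r ^ t) ⟨
        -- D has no loops, so having few in-neighbours in X is independent of v being outside X.
        u * r * r ^ t       ≡⟨ cong (_* r ^ t) (total-avoid a c v (λ X → ∣ N⁻ D v ∩ X ∣ <ᵇ suc j) (λ X → cong (_<ᵇ suc j)
                                 (trans (outside-∩ (N⁻ D v) v (v∉N⁻v v) X inside)
                                   (sym (outside-∩ (N⁻ D v) v (v∉N⁻v v) X outside))))) ⟩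
        c * w * r ^ t       ≡⟨ *-assoc c w (r ^ t) ⟩
        -- `total-few` asks only for j + t to be at most the in-degree, so the t taken from the
        -- minimum in-degree serves every vertex.
        c * (w * r ^ t)     ≤⟨ *-monoʳ-≤ c (total-few a c (N⁻ D v) j t (subst (_≤ d⁻ D v) (sym j+t≡δ) (δ⁻≤d⁻ v))) ⟩
        c * (b * c ^ t * r ^ n)  ≡⟨ solve 4 (λ c b x y → c :* (b :* x :* y) := b :* (c :* x) :* y) refl c b (c ^ t) (r ^ n) ⟩
        b * c ^ suc t * r ^ n ∎
        where
        u = total a c (λ X → ⟦ undominated (suc j) X v ⟧)
        w = total a c (few a c (suc j) (N⁻ D v))

    -- The mean is minimised by q = c / (a + c) with b (1 + t) q ^ t = 1; for
    -- any smaller q the second summand is at most q / (1 + t).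
    γ-bound′ : ∀ c r .{{_ : NonZero r}} j t → j + t ≡ δ⁻ D → c ≤ r →
               ((j + t) C j) * suc t * c ^ t ≤ r ^ t →
               γ (suc j) D * r * suc t + n * t * c ≤ n * r * suc t
    γ-bound′ c r j t j+t≡δ c≤r bc≤r = *-cancelʳ-≤ _ _ (r ^ t) {{m^n≢0 r t}} (begin
      (g * r * suc t + n * t * c) * s
        ≡⟨ solve 6 (λ g r t n c s → (g :* r :* (con 1 :+ t) :+ n :* t :* c) :* s
             := g :* (r :* s) :* (con 1 :+ t) :+ n :* t :* c :* s) refl g r t n c s ⟩
      g * r ^ suc t * suc t + n * t * c * s
        ≤⟨ +-monoˡ-≤ (n * t * c * s) (*-monoˡ-≤ (suc t) bound) ⟩
      n * (a * s + b * c ^ suc t) * suc t + n * t * c * s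
        ≡⟨ solve 7 (λ n a s b c x t → n :* (a :* s :+ b :* (c :* x)) :* (con 1 :+ t) :+ n :* t :* c :* s
             := n :* a :* s :* (con 1 :+ t) :+ n :* t :* c :* s :+ n :* c :* (b :* (con 1 :+ t) :* x))
             refl n a s b c (c ^ t) t ⟩
      n * a * s * suc t + n * t * c * s + n * c * (b * suc t * c ^ t)
        ≤⟨ +-monoʳ-≤ (n * a * s * suc t + n * t * c * s) (*-monoʳ-≤ (n * c) bc≤r) ⟩
      n * a * s * suc t + n * t * c * s + n * c * s
        ≡⟨ solve 5 (λ n a c s t → n :* a :* s :* (con 1 :+ t) :+ n :* t :* c :* s :+ n :* c :* s
             := n :* (a :+ c) :* (con 1 :+ t) :* s) refl n a c s t ⟩
      n * (a + c) * suc t * s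
        ≡⟨ cong (λ x → n * x * suc t * s) a+c≡r ⟩
      n * r * suc t * s ∎)
      where
      open ≤-Reasoning
      g = γ (suc j) D
      a = r ∸ c
      b = (j + t) C j
      s = r ^ t
      a+c≡r : a + c ≡ r
      a+c≡r = m∸n+n≡m c≤r
      bound : g * r ^ suc t ≤ n * (a * s + b * c ^ suc t)
      bound = subst (λ x → g * x ^ suc t ≤ n * (a * x ^ t + b * c ^ suc t)) a+c≡r
        (γ-bound a c {{subst NonZero (sym a+c≡r) it}} j t j+t≡δ)

-- Integer approximations to the two roots, and the choice of q.

module Roots where

  open import Data.Nat.Base
  open import Data.Nat.Properties as ℕ hiding (*-mono-≤)
  open import Data.Nat.Solver using (module +-*-Solver)
  open import Relation.Binary.PropositionalEquality

  open +-*-Solver using (solve; _:+_; _:*_; _:=_; con)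

  -- Divided by m, this places the approximations to a root of a positive integer at 1 or above; m
  -- is itself a candidate for the floor.
  m≤⌊am^q^1/q⌋ : ∀ a m q .{{_ : NonZero a}} .{{_ : NonZero q}} → m ≤ ⌊ a * m ^ q ^1/ q ⌋
  m≤⌊am^q^1/q⌋ a m q = ⌊^1/⌋-greatest (a * m ^ q) q (m≤n*m (m ^ q) a)

  module _ (b t m : ℕ) .{{_ : NonZero b}} .{{_ : NonZero t}} where

    open ≤-Reasoning

    -- Here t is the exponent called m in the idea above, and η = 1 / m. The fractions β / m and σ /
    -- m exceed the t-th roots of b and of (1 + t) ^ (1 + t) by at most η, and q = c / (β * σ).
    β σ c : ℕ
    β = suc ⌊ b * m ^ t ^1/ t ⌋
    σ = suc ⌊ suc t ^ suc t * m ^ t ^1/ t ⌋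
    c = suc t * (m * m)

    -- This makes q at most 1: β / m is at least 1, and σ / m exceeds 1 + t because (1 + t) ^ t ≤ (1
    -- + t) ^ (1 + t).
    c≤βσ : c ≤ β * σ
    c≤βσ = begin
      suc t * (m * m)   ≡⟨ solve 2 (λ t m → t :* (m :* m) := m :* (t :* m)) refl (suc t) m ⟩
      m * (suc t * m)   ≤⟨ ℕ.*-mono-≤ (m≤n⇒m≤1+n (m≤⌊am^q^1/q⌋ b m t)) (<⇒≤ (^-cancelʳ-< t [1+t]m<σ)) ⟩
      β * σ             ∎
      where
      [1+t]m<σ : (suc t * m) ^ t < σ ^ t
      [1+t]m<σ = begin-strict
        (suc t * m) ^ t           ≡⟨ ^-distribʳ-* (suc t) m t ⟩
        suc t ^ t * m ^ t         ≤⟨ *-monoˡ-≤ (m ^ t) (m≤n*m (suc t ^ t) (suc t)) ⟩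
        suc t ^ suc t * m ^ t     <⟨ ⌊^1/⌋-upper (suc t ^ suc t * m ^ t) t ⟩
        σ ^ t                     ∎

    -- This is b (1 + t) q ^ t ≤ 1, the condition of `γ-bound′`. It holds because both roots in the
    -- denominator of q are rounded up.
    b[1+t]c^t≤[βσ]^t : b * suc t * c ^ t ≤ (β * σ) ^ t
    b[1+t]c^t≤[βσ]^t = begin
      b * suc t * c ^ t
        ≡⟨ cong (b * suc t *_) (trans (^-distribʳ-* (suc t) (m * m) t) (cong (suc t ^ t *_) (^-distribʳ-* m m t))) ⟩
      b * suc t * (suc t ^ t * (m ^ t * m ^ t))
        ≡⟨ solve 4 (λ b t x y → b :* t :* (x :* (y :* y)) := b :* y :* (t :* x :* y)) refl b (suc t) (suc t ^ t) (m ^ t) ⟩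
      b * m ^ t * (suc t ^ suc t * m ^ t)
        ≤⟨ <⇒≤ (*-mono-< (⌊^1/⌋-upper (b * m ^ t) t) (⌊^1/⌋-upper (suc t ^ suc t * m ^ t) t)) ⟩
      β ^ t * σ ^ t
        ≡⟨ ^-distribʳ-* β σ t ⟨
      (β * σ) ^ t ∎

-- Rational form of the bound, with an explicit error term.

module Rationals where

  open import Data.Integer.Base as ℤ using (+_)
  import Data.Integer.Properties as ℤ
  open import Data.Nat.Base as ℕ using (ℕ; zero; suc)
  import Data.Nat.Properties as ℕ
  open import Data.Product.Base using (∃-syntax; _,_; proj₁; proj₂)
  open import Data.Rational.Base
  open import Data.Rational.Properties
  open import Data.Rational.Solver using (module +-*-Solver)
  open import Data.Rational.Unnormalised.Base as ℚᵘ using (mkℚᵘ)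
  import Data.Rational.Unnormalised.Properties as ℚᵘ
  open import Data.Sum.Base using (inj₁; inj₂)
  open import Relation.Binary.PropositionalEquality
  import Relation.Binary.Reasoning.Setoid as ≈-Reasoning

  open +-*-Solver using (solve; _:+_; _:*_; _:-_; _:=_; con)

  ι : ℕ → ℚ
  ι n = + n / 1

  ι-+ : ∀ m n → ι (m ℕ.+ n) ≡ ι m + ι n
  ι-+ zero    n = sym (+-identityˡ (ι n))
  ι-+ (suc m) n = begin
    ι (suc m ℕ.+ n)       ≡⟨ [1+t]/d (m ℕ.+ n) 1 ⟩
    1ℚ + ι (m ℕ.+ n)      ≡⟨ cong (λ x → 1ℚ + x) (ι-+ m n) ⟩
    1ℚ + (ι m + ι n)      ≡⟨ +-assoc 1ℚ (ι m) (ι n) ⟨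
    1ℚ + ι m + ι n        ≡⟨ cong (_+ ι n) ([1+t]/d m 1) ⟨
    ι (suc m) + ι n       ∎
    where open ≡-Reasoning

  ι-* : ∀ m n → ι (m ℕ.* n) ≡ ι m * ι n
  ι-* zero    n = sym (*-zeroˡ (ι n))
  ι-* (suc m) n = begin
    ι (n ℕ.+ m ℕ.* n)     ≡⟨ ι-+ n (m ℕ.* n) ⟩
    ι n + ι (m ℕ.* n)     ≡⟨ cong (λ x → ι n + x) (ι-* m n) ⟩
    ι n + ι m * ι n       ≡⟨ solve 2 (λ x y → y :+ x :* y := (con 1ℚ :+ x) :* y) refl (ι m) (ι n) ⟩
    (1ℚ + ι m) * ι n      ≡⟨ cong (_* ι n) ([1+t]/d m 1) ⟨
    ι (suc m) * ι n       ∎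
    where open ≡-Reasoning

  ι-mono-≤ : ∀ {m n} → m ℕ.≤ n → ι m ≤ ι n
  ι-mono-≤ {m} {n} m≤n with ℕ.m≤n⇒m<n∨m≡n m≤n
  ... | inj₁ m<n  = <⇒≤ (/-mono-< m 1 n 1 (ℕ.*-monoˡ-< 1 m<n))
  ... | inj₂ refl = ≤-refl

  0<ι : ∀ n .{{_ : ℕ.NonZero n}} → 0ℚ < ι n
  0<ι n@(suc _) = /-mono-< 0 1 n 1 (ℕ.s≤s ℕ.z≤n)

  0≤ι : ∀ n → 0ℚ ≤ ι n
  0≤ι n = ι-mono-≤ {0} {n} ℕ.z≤n

  a/m*m≡a : ∀ a m .{{_ : ℕ.NonZero m}} → + a / m * ι m ≡ ι a
  a/m*m≡a a m@(suc m-1) = toℚᵘ-injective (begin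
    toℚᵘ (+ a / m * ι m)            ≈⟨ toℚᵘ-homo-* (+ a / m) (ι m) ⟩
    toℚᵘ (+ a / m) ℚᵘ.* toℚᵘ (ι m)  ≈⟨ ℚᵘ.*-cong (toℚᵘ-fromℚᵘ (mkℚᵘ (+ a) m-1)) (toℚᵘ-fromℚᵘ (mkℚᵘ (+ m) 0)) ⟩
    mkℚᵘ (+ a) m-1 ℚᵘ.* mkℚᵘ (+ m) 0  ≈⟨ ℚᵘ.*≡* (trans (ℤ.*-identityʳ _) (cong (λ x → + a ℤ.* + x) (sym (ℕ.*-identityʳ m)))) ⟩
    mkℚᵘ (+ a) 0                    ≈⟨ toℚᵘ-fromℚᵘ (mkℚᵘ (+ a) 0) ⟨
    toℚᵘ (ι a)                      ∎)
    where
    open ≈-Reasoning ℚᵘ.≃-setoid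

  cancel : ∀ {p q r} → 0ℚ < r → p * r ≤ q * r → p ≤ q
  cancel {r = r} 0<r = *-cancelʳ-≤-pos r {{positive 0<r}}

  1≤a/m : ∀ a m .{{_ : ℕ.NonZero m}} → m ℕ.≤ a → 1ℚ ≤ + a / m
  1≤a/m a m m≤a = cancel (0<ι m) (begin
    1ℚ * ι m       ≡⟨ *-identityˡ (ι m) ⟩
    ι m            ≤⟨ ι-mono-≤ m≤a ⟩
    ι a            ≡⟨ a/m*m≡a a m ⟨
    + a / m * ι m  ∎)
    where open ≤-Reasoning

  1≤p⇒inv[p]≤1 : ∀ {p} → 1ℚ ≤ p → inv p ≤ 1ℚ
  1≤p⇒inv[p]≤1 {p} 1≤p with 0<u , pu≡1 ← inv-pos (<-≤-trans (positive⁻¹ 1ℚ) 1≤p) = begin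
    inv p        ≡⟨ *-identityˡ (inv p) ⟨
    1ℚ * inv p   ≤⟨ *-monoʳ-≤-nonNeg (inv p) {{nonNegative (<⇒≤ 0<u)}} 1≤p ⟩
    p * inv p    ≡⟨ pu≡1 ⟩
    1ℚ           ∎
    where open ≤-Reasoning

  1≤p*q : ∀ {p q} → 1ℚ ≤ p → 1ℚ ≤ q → 1ℚ ≤ p * q
  1≤p*q 1≤p 1≤q = *-mono-≤ (<⇒≤ (positive⁻¹ 1ℚ)) (≤-trans (<⇒≤ (positive⁻¹ 1ℚ)) 1≤p) 1≤p 1≤q

  -- p q = (p + η) (q + η) (1 − η / (p + η) − η / (q + η)) + η², and both
  -- denominators are at least 1.
  inv-perturb : ∀ {p q η} → 1ℚ ≤ p → 1ℚ ≤ q → 0ℚ ≤ η →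
                (p + η) * (q + η) * inv (p * q) ≤ 1ℚ + ι 2 * η * ((p + η) * (q + η))
  inv-perturb {p} {q} {η} 1≤p 1≤q 0≤η = begin
    w * u
      ≤⟨ *-monoʳ-≤-nonNeg u {{nonNegative (<⇒≤ (proj₁ u-inv))}} w≤pq+2ηw ⟩
    (p * q + ι 2 * η * w) * u
      ≡⟨ *-distribʳ-+ u (p * q) (ι 2 * η * w) ⟩
    p * q * u + ι 2 * η * w * u
      ≤⟨ +-mono-≤ (≤-reflexive (proj₂ u-inv)) (*-monoˡ-≤-nonNeg (ι 2 * η * w) {{nonNegative 0≤2ηw}} (1≤p⇒inv[p]≤1 (1≤p*q 1≤p 1≤q))) ⟩
    1ℚ + ι 2 * η * w * 1ℚ
      ≡⟨ cong (λ x → 1ℚ + x) (*-identityʳ (ι 2 * η * w)) ⟩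
    1ℚ + ι 2 * η * w ∎
    where
    open ≤-Reasoning
    x = p + η
    y = q + η
    w = x * y
    u = inv (p * q)
    0≤1 = <⇒≤ (positive⁻¹ 1ℚ)
    u-inv = inv-pos (<-≤-trans (positive⁻¹ 1ℚ) (1≤p*q 1≤p 1≤q))
    1≤x : 1ℚ ≤ x
    1≤x = +-mono-≤ 1≤p 0≤η
    1≤y : 1ℚ ≤ y
    1≤y = +-mono-≤ 1≤q 0≤η
    0≤x = ≤-trans 0≤1 1≤x
    0≤y = ≤-trans 0≤1 1≤y
    *-nonneg : ∀ {r s} → 0ℚ ≤ r → 0ℚ ≤ s → 0ℚ ≤ r * s
    *-nonneg {r} {s} 0≤r 0≤s = *-mono-≤ {0ℚ} {r} {0ℚ} {s} ≤-refl 0≤r 0≤r 0≤s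
    0≤2ηw : 0ℚ ≤ ι 2 * η * w
    0≤2ηw = *-nonneg (*-nonneg (0≤ι 2) 0≤η) (*-nonneg 0≤x 0≤y)
    x+y≤2w : x + y ≤ w + w
    x+y≤2w = +-mono-≤
      (≤-trans (≤-reflexive (sym (*-identityʳ x))) (*-mono-≤ 0≤1 0≤x ≤-refl 1≤y))
      (≤-trans (≤-reflexive (sym (*-identityˡ y))) (*-mono-≤ 0≤y 0≤x 1≤x ≤-refl))
    w≤pq+2ηw : w ≤ p * q + ι 2 * η * w
    w≤pq+2ηw = begin
      w                          ≡⟨ +-identityʳ w ⟨
      w + 0ℚ                     ≤⟨ +-monoʳ-≤ w (*-nonneg 0≤η 0≤η) ⟩
      w + η * η                  ≡⟨ solve 3 (λ p q η → (p :+ η) :* (q :+ η) :+ η :* η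
                                      := p :* q :+ η :* ((p :+ η) :+ (q :+ η))) refl p q η ⟩
      p * q + η * (x + y)        ≤⟨ +-monoʳ-≤ (p * q) (*-monoˡ-≤-nonNeg η {{nonNegative 0≤η}} x+y≤2w) ⟩
      p * q + η * (w + w)        ≡⟨ cong (λ x → p * q + x) (solve 2 (λ η w → η :* (w :+ w) := con (ι 2) :* η :* w) refl η w) ⟩
      p * q + ι 2 * η * w        ∎

  -- Here β and σ are the floors themselves, so p = β / m and q = σ / m are the approximations from
  -- below. Division of the hypothesis by m ^ 2 gives a bound with 1 / ((p + η) * (q + η));
  -- replacing this by 1 / (p * q) costs at most 2 * η, hence the error term.
  mean-bound : ∀ g n t m β σ .{{_ : ℕ.NonZero m}} → m ℕ.≤ β → m ℕ.≤ σ →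
               g ℕ.* (suc β ℕ.* suc σ) ℕ.+ n ℕ.* t ℕ.* (m ℕ.* m) ℕ.≤ n ℕ.* (suc β ℕ.* suc σ) →
               ι g ≤ (1ℚ - ι t * inv (+ β / m * (+ σ / m))) * ι n + ι (n ℕ.* t ℕ.* 2) * (+ 1 / m)
  mean-bound g n t m β σ m≤β m≤σ g-bound = cancel 0<w (begin
    G * w
      ≡⟨ solve 3 (λ G w a → G :* w := G :* w :+ a :- a) refl G w (N * T) ⟩
    G * w + N * T - N * T
      ≤⟨ +-monoˡ-≤ (- (N * T)) Gw+NT≤Nw ⟩
    N * w - N * T
      -- The product w * u is inserted so that `inv-perturb` can replace it by 1 + 2 * η * w. The 1
      -- then cancels the final N * T, and the rest is the error, still multiplied by w.
      ≡⟨ solve 5 (λ N w T u h → N :* w :- N :* T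
           := N :* w :- (N :* T) :* (w :* u) :+ (N :* T) :* (w :* u) :- N :* T) refl N w T u (ι 2 * η) ⟩
    N * w - N * T * (w * u) + N * T * (w * u) - N * T
      ≤⟨ +-monoˡ-≤ (- (N * T)) (+-monoʳ-≤ (N * w - N * T * (w * u))
           (*-monoˡ-≤-nonNeg (N * T) {{nonNegative 0≤NT}} (inv-perturb 1≤p 1≤q 0≤η))) ⟩
    N * w - N * T * (w * u) + N * T * (1ℚ + ι 2 * η * w) - N * T
      ≡⟨ solve 5 (λ N w T u η → N :* w :- N :* T :* (w :* u) :+ N :* T :* (con 1ℚ :+ con (ι 2) :* η :* w) :- N :* T
           := ((con 1ℚ :- T :* u) :* N :+ N :* T :* con (ι 2) :* η) :* w) refl N w T u η ⟩
    ((1ℚ - T * u) * N + N * T * ι 2 * η) * w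
      ≡⟨ cong (λ x → ((1ℚ - T * u) * N + x * η) * w)
           (trans (ι-* (n ℕ.* t) 2) (cong (_* ι 2) (ι-* n t))) ⟨
    ((1ℚ - T * u) * N + ι (n ℕ.* t ℕ.* 2) * η) * w ∎)
    where
    open ≤-Reasoning
    G = ι g
    N = ι n
    T = ι t
    M = ι m
    p = + β / m
    q = + σ / m
    η = + 1 / m
    u = inv (p * q)
    w = (p + η) * (q + η)
    1≤p = 1≤a/m β m m≤β
    1≤q = 1≤a/m σ m m≤σ
    0<η : 0ℚ < η
    0<η = /-mono-< 0 1 1 m (ℕ.s≤s ℕ.z≤n)
    0≤η = <⇒≤ 0<η
    0<w : 0ℚ < w
    0<w = *-pos (+-mono-<-≤ (<-≤-trans (positive⁻¹ 1ℚ) 1≤p) 0≤η) (+-mono-<-≤ (<-≤-trans (positive⁻¹ 1ℚ) 1≤q) 0≤η)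
    0≤NT : 0ℚ ≤ N * T
    0≤NT = subst (0ℚ ≤_) (ι-* n t) (0≤ι (n ℕ.* t))
    [a/m+η]M : ∀ a → (+ a / m + η) * M ≡ ι (suc a)
    [a/m+η]M a = trans (cong (_* M) (trans (+-comm (+ a / m) η) (sym ([1+t]/d a m)))) (a/m*m≡a (suc a) m)
    wMM : w * (M * M) ≡ ι (suc β ℕ.* suc σ)
    wMM = begin-equality
      w * (M * M)                    ≡⟨ solve 3 (λ x y M → x :* y :* (M :* M) := x :* M :* (y :* M)) refl (p + η) (q + η) M ⟩
      (p + η) * M * ((q + η) * M)    ≡⟨ cong₂ _*_ ([a/m+η]M β) ([a/m+η]M σ) ⟩
      ι (suc β) * ι (suc σ)          ≡⟨ ι-* (suc β) (suc σ) ⟨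
      ι (suc β ℕ.* suc σ)            ∎
    Gw+NT≤Nw : G * w + N * T ≤ N * w
    Gw+NT≤Nw = cancel (*-pos (0<ι m) (0<ι m)) (begin
      (G * w + N * T) * (M * M)
        ≡⟨ solve 5 (λ G w N T M → (G :* w :+ N :* T) :* (M :* M) := G :* (w :* (M :* M)) :+ N :* T :* (M :* M)) refl G w N T M ⟩
      G * (w * (M * M)) + N * T * (M * M)
        ≡⟨ cong₂ (λ x y → G * x + y) wMM
             (cong₂ _*_ (sym (ι-* n t)) (sym (ι-* m m))) ⟩
      G * ι (suc β ℕ.* suc σ) + ι (n ℕ.* t) * ι (m ℕ.* m)
        ≡⟨ cong₂ _+_ (ι-* g (suc β ℕ.* suc σ)) (ι-* (n ℕ.* t) (m ℕ.* m)) ⟨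
      ι (g ℕ.* (suc β ℕ.* suc σ)) + ι (n ℕ.* t ℕ.* (m ℕ.* m))
        ≡⟨ ι-+ (g ℕ.* (suc β ℕ.* suc σ)) (n ℕ.* t ℕ.* (m ℕ.* m)) ⟨
      ι (g ℕ.* (suc β ℕ.* suc σ) ℕ.+ n ℕ.* t ℕ.* (m ℕ.* m))
        ≤⟨ ι-mono-≤ g-bound ⟩
      ι (n ℕ.* (suc β ℕ.* suc σ))
        ≡⟨ ι-* n (suc β ℕ.* suc σ) ⟩
      N * ι (suc β ℕ.* suc σ)
        ≡⟨ cong (N *_) wMM ⟨
      N * (w * (M * M))
        ≡⟨ *-assoc N w (M * M) ⟨
      N * w * (M * M) ∎)

  -- The conclusion is `_≤ᴿ_` unfolded for a constant left-hand side; the error tends to 0 by the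
  -- Archimedean property.
  vanishing-error : ∀ k {x : ℚ} (y : ℕ → ℚ) → (∀ i → x ≤ y i + ι k * (+ 1 / suc i)) →
                    ∀ ε → 0ℚ < ε → ∃[ N ] (∀ i → N ℕ.≤ i → x ≤ y i + ε)
  vanishing-error k {x} y x≤y ε 0<ε =
    -- The divisor is k + 1 because k may be 0.
    let η , 0<η , eq = split ε (ι (suc k)) 0<ε (0<ι (suc k))
        N , small = archimedean η 0<η
    in N , λ i N≤i → begin
      x                              ≤⟨ x≤y i ⟩
      y i + ι k * (+ 1 / suc i)      ≤⟨ +-monoʳ-≤ (y i) (*-mono-≤ (<⇒≤ (/-mono-< 0 1 1 (suc i) (ℕ.s≤s ℕ.z≤n)))
                                          (0≤ι (suc k)) (ι-mono-≤ (ℕ.n≤1+n k)) (<⇒≤ (small i N≤i))) ⟩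
      y i + ι (suc k) * η            ≡⟨ cong (λ z → y i + z) eq ⟩
      y i + ε                        ∎
    where open ≤-Reasoning

-- Passage from the approximants to the real bound.

module Limit where

  open import Data.Integer.Base using (+_)
  open import Data.Nat.Base
  open import Data.Nat.Combinatorics using (_C_)
  open import Data.Nat.Properties hiding (*-mono-≤)
  open import Data.Nat.Solver using (module +-*-Solver)
  open import Data.Product.Base using (∃-syntax)
  import Data.Rational.Base as ℚ
  open import Function.Base using (it)
  open import Relation.Binary.PropositionalEquality

  open +-*-Solver using (solve; _:+_; _:*_; _:=_; con)
  open Averaging
  open Rationals
  open Roots

  -- The counting bound at denominator m = i + 1, so that the i-th terms of the two root sequences
  -- appear.
  γ-approx : ∀ {n} (D : Digraph n) j t .{{_ : NonZero t}} .{{_ : NonZero ((j + t) C j)}} →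
             j + t ≡ δ⁻ D → ∀ i →
             ι (γ (suc j) D) ℚ.≤
             (ι 1 ℚ.- ι t ℚ.* inv (approx ((j + t) C j) t i ℚ.* approx (suc t ^ suc t) t i)) ℚ.* ι n
             ℚ.+ ι (n * t * 2) ℚ.* (+ 1 ℚ./ suc i)
  γ-approx {n} D j t j+t≡δ i = mean-bound g n t m _ _
    (m≤⌊am^q^1/q⌋ b m t) (m≤⌊am^q^1/q⌋ (suc t ^ suc t) m t {{m^n≢0 (suc t) (suc t)}})
    -- The numerator of q contains the factor 1 + t, which cancels the one in `γ-bound′` and leaves
    -- n * t * (m * m).
    (*-cancelʳ-≤ _ _ (suc t) (begin
      (g * r + n * t * (m * m)) * suc t
        ≡⟨ solve 5 (λ g r n t x → (g :* r :+ n :* t :* x) :* (con 1 :+ t) := g :* r :* (con 1 :+ t) :+ n :* t :* ((con 1 :+ t) :* x))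
             refl g r n t (m * m) ⟩
      g * r * suc t + n * t * (suc t * (m * m))
        ≤⟨ γ-bound′ D (c b t m) r j t j+t≡δ (c≤βσ b t m) (b[1+t]c^t≤[βσ]^t b t m) ⟩
      n * r * suc t ∎))
    where
    open ≤-Reasoning
    g = γ (suc j) D
    b = (j + t) C j
    m = suc i
    r = β b t m * σ b t m

  -- The radicands a and e and the root index q are variables with equations, because the powers in
  -- the theorem compute to these numbers only up to propositional equality.
  γ-limit : ∀ {n} (D : Digraph n) j t .{{_ : NonZero t}} → j + t ≡ δ⁻ D →
            ∀ a e q → a ≡ (j + t) C j → e ≡ suc t ^ suc t → q ≡ t →
            ∀ ε → ℚ.0ℚ ℚ.< ε → ∃[ N ] (∀ i → N ≤ i →
            ι (γ (suc j) D) ℚ.≤ (ι 1 ℚ.- ι t ℚ.* inv (approx a t i ℚ.* approx e q i)) ℚ.* ι n ℚ.+ ε)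
  γ-limit {n} D j t j+t≡δ a e q refl refl refl = vanishing-error (n * t * 2)
    (λ i → (ι 1 ℚ.- ι t ℚ.* inv (approx a t i ℚ.* approx e t i)) ℚ.* ι n)
    (γ-approx D j t {{it}} {{C-nonZero (m≤m+n j t)}} j+t≡δ)

-- The exponents of the statement.

open import Data.Integer.Base using (+_; ∣_∣)
open import Data.Nat.Base using (ℕ; suc; _∸_; _≤_; _^_)
open import Data.Nat.Combinatorics using (_C_)
open import Data.Nat.Properties using (+-comm; +-identityʳ; +-suc; *-identityʳ; m+[n∸m]≡n)
open import Data.Rational.Unnormalised.Base using (1ℚᵘ; _+_; _/_; ↥_; ↧ₙ_)
open import Relation.Binary.PropositionalEquality using (cong; sym; trans)

theorem2 :
  ∀ (n : ℕ) (D : Digraph n) (k : ℕ) → 1 ≤ k → (k≤δ : k ≤ δ⁻ D) →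
  let δ  = δ⁻ D
      δ′ = suc (δ ∸ k)
      instance _ = C-nonZero (k∸1≤ k≤δ)
  in fromℕ (γ k D) ≤ᴿ
     (fromℕ 1 -ᴿ
        fromℕ δ′ ÷ᴿ ((δ C (k ∸ 1)) ^ᴿ (+ 1 / δ′) *ᴿ suc δ′ ^ᴿ (1ℚᵘ + + 1 / δ′)))
     *ᴿ fromℕ n
theorem2 n D (suc j) 1≤k k≤δ = Limit.γ-limit D j δ′ j+δ′≡δ
  ((δ C j) ^ ∣ ↥ 1/δ′ ∣) (suc δ′ ^ ∣ ↥ 1+1/δ′ ∣) (↧ₙ 1+1/δ′)
  -- The exponent 1 / δ′ contributes a first power. The unnormalised sum 1 + 1 / δ′ has numerator 1
  -- * δ′ + 1 * 1 and denominator 1 * δ′, which the other two equations simplify.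
  (trans (*-identityʳ (δ C j)) (cong (_C j) (sym j+δ′≡δ)))
  (cong (suc δ′ ^_) (trans (+-comm _ 1) (cong suc (+-identityʳ δ′))))
  (+-identityʳ δ′)
  where
  δ = δ⁻ D
  δ′ = suc (δ ∸ suc j)
  1/δ′ = + 1 / δ′
  1+1/δ′ = 1ℚᵘ + 1/δ′
  j+δ′≡δ = trans (+-suc j (δ ∸ suc j)) (m+[n∸m]≡n k≤δ)
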